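{- The statement $OTT(\mathrm{cov}K)$ is false.
   Context: $\mathrm{cov}K$ is the least cardinal $\kappa$ such that the real line can be covered by $\kappa$ many nowhere dense sets. For a cardinal $\kappa$, $OTT(\kappa)$ is the following statement: for every finite $n>2$, every countable consistent theory $T$ in $L_n$ (first order logic restricted to the first $n$ variables) whose Tarski–Lindenbaum algebra $\mathfrak{Fm}_T$ belongs to $\mathfrak{Nr}_n\mathsf{CA}_\omega$, and every family of $\kappa$ many non-principal types of $T$, there is a model of $T$ omitting all types in the family. Here a type $\Gamma$ (a set of $L_n$ formulas) is non-principal if there is no formula $\psi$ consistent with $T$ with $T\models\psi\to\phi$ for all $\phi\in\Gamma$; a model $\mathfrak M$ omits $\Gamma$ if no assignment $s\in{}^nM$ satisfies all formulas in $\Gamma$. $\mathsf{CA}_\omega$ is the class of cylindric algebras of dimension $\omega$, and $\mathfrak{Nr}_n\mathsf{CA}_\omega$ is the class of (isomorphic copies of) neat $n$-reducts $\mathfrak{Nr}_n\mathfrak B$, $\mathfrak B\in\mathsf{CA}_\omega$, where $\mathfrak{Nr}_n\mathfrak B$ has universe $\{b:c_ib=b\text{ for all }i\ge n\}$ and the operations of $\mathfrak B$ with indices $<n$. -}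

module Defs where

open import Algebra.Lattice.Bundles using (BooleanAlgebra)
import Algebra.Lattice.Properties.BooleanAlgebra as BAProperties
open import Data.Fin.Base using (Fin; toℕ)
open import Data.Fin.Properties using (toℕ<n)
open import Data.Nat.Base as ℕ using (ℕ)
import Data.Nat.Properties as ℕ
open import Data.Product using (Σ; ∃; _×_; _,_; proj₁)
open import Data.Rational.Base as ℚ using (ℚ)
open import Data.Sum.Base using (_⊎_)
open import Data.Empty using (⊥)
open import Data.Vec.Base using (Vec; lookup; map; _[_]≔_)
import Data.Vec.Membership.Propositional as Vec
open import Function.Bundles using (_⇔_; _↣_)
open import Function.Definitions using (Congruent; Injective; Surjective)
open import Level using (Level; 0ℓ; suc; _⊔_)
open import Relation.Binary.Core using (Rel)
open import Relation.Binary.Definitions using (_Respects_)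
open import Relation.Binary.PropositionalEquality using (_≡_; _≢_; sym)
import Relation.Binary.Reasoning.Setoid as SetoidReasoning
open import Relation.Nullary.Negation using (¬_)
open import Relation.Unary using (Pred; _∈_)

------------------------------------------------------------------------

-- Two-sided Dedekind cuts: L q means q < x and U q means x < q.

record ℝ : Set₁ where
  field
    L U         : Pred ℚ 0ℓ
    L-inhabited : ∃ L
    U-inhabited : ∃ U
    L-rounded   : ∀ p → L p ⇔ (∃ λ q → p ℚ.< q × L q)
    U-rounded   : ∀ q → U q ⇔ (∃ λ p → p ℚ.< q × U p)
    disjoint    : ∀ q → ¬ (L q × U q)
    located     : ∀ p q → p ℚ.< q → L p ⊎ U q

infix 4 _≃_

_≃_ : Rel ℝ 0ℓ
x ≃ y = (∀ q → ℝ.L x q ⇔ ℝ.L y q) × (∀ q → ℝ.U x q ⇔ ℝ.U y q)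

-- The open interval with rational endpoints p and q; these form a base
-- of the topology.

Interval : ℚ → ℚ → Pred ℝ 0ℓ
Interval p q x = ℝ.L x p × ℝ.U x q

Closure : ∀ {ℓ} → Pred ℝ ℓ → Pred ℝ (suc 0ℓ ⊔ ℓ)
Closure N x = ∀ p q → x ∈ Interval p q → ∃ λ y → y ∈ Interval p q × y ∈ N

Interior : ∀ {ℓ} → Pred ℝ ℓ → Pred ℝ (suc 0ℓ ⊔ ℓ)
Interior N x = ∃ λ p → ∃ λ q → x ∈ Interval p q × (∀ y → y ∈ Interval p q → y ∈ N)

NowhereDense : Pred ℝ 0ℓ → Set₁
NowhereDense N = ∀ x → ¬ (x ∈ Interior (Closure N))

-- A cover of the real line by nowhere dense sets indexed by K.  Reals
-- are compared by _≃_, so a set of reals must respect it.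

record NowhereDenseCover (K : Set) : Set₁ where
  field
    N            : K → Pred ℝ 0ℓ
    respects     : ∀ k → N k Respects _≃_
    nowhereDense : ∀ k → NowhereDense (N k)
    covers       : ∀ x → ∃ λ k → x ∈ N k

-- Cardinals are represented by types, compared by injections.  A type
-- has cardinality cov K when it indexes a cover and embeds in every
-- other type that does.

record IsCovK (K : Set) : Set₁ where
  field
    cover : NowhereDenseCover K
    least : (K′ : Set) → NowhereDenseCover K′ → K ↣ K′

------------------------------------------------------------------------

record RawCylindricAlgebra (I : Set) (c ℓ : Level) : Set (suc (c ⊔ ℓ)) where
  infix  8 -_
  infixr 7 _∙_
  infixr 6 _+_
  infix  4 _≈_
  field
    Carrier : Set c
    _≈_     : Rel Carrier ℓ
    _+_     : Carrier → Carrier → Carrier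
    _∙_     : Carrier → Carrier → Carrier
    -_      : Carrier → Carrier
    𝟘       : Carrier
    𝟙       : Carrier
    cyl     : I → Carrier → Carrier
    diag    : I → I → Carrier

-- The inequality x ≤ cyl i x is expressed by
-- x ∧ cyl i x ≈ x.

record CylindricAlgebra (I : Set) (c ℓ : Level) : Set (suc (c ⊔ ℓ)) where
  field
    booleanAlgebra : BooleanAlgebra c ℓ
  open BooleanAlgebra booleanAlgebra public renaming (¬_ to ∁_; ⊥ to 𝟘; ⊤ to 𝟙)
  field
    cyl      : I → Carrier → Carrier
    diag     : I → I → Carrier
    cyl-cong : ∀ i → Congruent _≈_ _≈_ (cyl i)
    cyl-𝟘    : ∀ i → cyl i 𝟘 ≈ 𝟘
    cyl-incr : ∀ i x → x ∧ cyl i x ≈ x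
    cyl-∧    : ∀ i x y → cyl i (x ∧ cyl i y) ≈ cyl i x ∧ cyl i y
    cyl-comm : ∀ i j x → cyl i (cyl j x) ≈ cyl j (cyl i x)
    diag-𝟙   : ∀ i → diag i i ≈ 𝟙
    diag-cyl : ∀ i j k → k ≢ i → k ≢ j → diag i j ≈ cyl k (diag i k ∧ diag k j)
    diag-sub : ∀ i j x → i ≢ j →
               cyl i (diag i j ∧ x) ∧ cyl i (diag i j ∧ ∁ x) ≈ 𝟘

record _≅_ {I : Set} {a ℓ₁ b ℓ₂ : Level}
           (A : RawCylindricAlgebra I a ℓ₁) (B : RawCylindricAlgebra I b ℓ₂) :
           Set (a ⊔ b ⊔ ℓ₁ ⊔ ℓ₂) where
  private
    module A = RawCylindricAlgebra A
    module B = RawCylindricAlgebra B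
  field
    to         : A.Carrier → B.Carrier
    cong       : Congruent  A._≈_ B._≈_ to
    injective  : Injective  A._≈_ B._≈_ to
    surjective : Surjective A._≈_ B._≈_ to
    +-homo     : ∀ x y → to (x A.+ y) B.≈ to x B.+ to y
    ∙-homo     : ∀ x y → to (x A.∙ y) B.≈ to x B.∙ to y
    -‿homo     : ∀ x → to (A.- x) B.≈ B.- to x
    𝟘-homo     : to A.𝟘 B.≈ B.𝟘
    𝟙-homo     : to A.𝟙 B.≈ B.𝟙
    cyl-homo   : ∀ i x → to (A.cyl i x) B.≈ B.cyl i (to x)
    diag-homo  : ∀ i j → to (A.diag i j) B.≈ B.diag i j

module Fixed {I : Set} {c ℓ : Level} (𝔅 : CylindricAlgebra I c ℓ) (i : I) where
  open CylindricAlgebra 𝔅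
  open BAProperties booleanAlgebra
  open SetoidReasoning setoid

  FixedBy : Pred Carrier ℓ
  FixedBy b = cyl i b ≈ b

  𝟙-fixed : FixedBy 𝟙
  𝟙-fixed = begin
    cyl i 𝟙      ≈⟨ ∧-identityˡ _ ⟨
    𝟙 ∧ cyl i 𝟙  ≈⟨ cyl-incr i 𝟙 ⟩
    𝟙            ∎

  cyl-fixed : ∀ x → FixedBy (cyl i x)
  cyl-fixed x = begin
    cyl i (cyl i x)      ≈⟨ cyl-cong i (∧-identityˡ _) ⟨
    cyl i (𝟙 ∧ cyl i x)  ≈⟨ cyl-∧ i 𝟙 x ⟩
    cyl i 𝟙 ∧ cyl i x    ≈⟨ ∧-congʳ 𝟙-fixed ⟩
    𝟙 ∧ cyl i x          ≈⟨ ∧-identityˡ _ ⟩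
    cyl i x              ∎

  ≈-fixed : ∀ {x y} → x ≈ y → FixedBy y → FixedBy x
  ≈-fixed {x} {y} x≈y fy = begin
    cyl i x  ≈⟨ cyl-cong i x≈y ⟩
    cyl i y  ≈⟨ fy ⟩
    y        ≈⟨ x≈y ⟨
    x        ∎

  ∧-fixed : ∀ {x y} → FixedBy x → FixedBy y → FixedBy (x ∧ y)
  ∧-fixed {x} {y} fx fy = begin
    cyl i (x ∧ y)        ≈⟨ cyl-cong i (∧-congˡ fy) ⟨
    cyl i (x ∧ cyl i y)  ≈⟨ cyl-∧ i x y ⟩
    cyl i x ∧ cyl i y    ≈⟨ ∧-cong fx fy ⟩
    x ∧ y                ∎

  ∁-fixed : ∀ {x} → FixedBy x → FixedBy (∁ x)
  ∁-fixed {x} fx = begin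
    z                    ≈⟨ ∧-identityʳ _ ⟨
    z ∧ 𝟙                ≈⟨ ∧-congˡ (∨-complementʳ x) ⟨
    z ∧ (x ∨ ∁ x)        ≈⟨ ∧-distribˡ-∨ _ _ _ ⟩
    (z ∧ x) ∨ (z ∧ ∁ x)  ≈⟨ ∨-cong z∧x≈𝟘 (∧-comm _ _) ⟩
    𝟘 ∨ (∁ x ∧ z)        ≈⟨ ∨-identityˡ _ ⟩
    ∁ x ∧ z              ≈⟨ cyl-incr i (∁ x) ⟩
    ∁ x                  ∎
    where
    z : Carrier
    z = cyl i (∁ x)
    z∧x≈𝟘 : z ∧ x ≈ 𝟘
    z∧x≈𝟘 = begin
      z ∧ x                  ≈⟨ ∧-congˡ fx ⟨
      z ∧ cyl i x            ≈⟨ cyl-∧ i (∁ x) x ⟨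
      cyl i (∁ x ∧ cyl i x)  ≈⟨ cyl-cong i (∧-congˡ fx) ⟩
      cyl i (∁ x ∧ x)        ≈⟨ cyl-cong i (∧-complementˡ x) ⟩
      cyl i 𝟘                ≈⟨ cyl-𝟘 i ⟩
      𝟘                      ∎

  ∨-fixed : ∀ {x y} → FixedBy x → FixedBy y → FixedBy (x ∨ y)
  ∨-fixed {x} {y} fx fy = ≈-fixed x∨y≈ (∁-fixed (∧-fixed (∁-fixed fx) (∁-fixed fy)))
    where
    x∨y≈ : x ∨ y ≈ ∁ (∁ x ∧ ∁ y)
    x∨y≈ = begin
      x ∨ y            ≈⟨ ¬-involutive _ ⟨
      ∁ (∁ (x ∨ y))    ≈⟨ ¬-cong (deMorgan₂ x y) ⟩
      ∁ (∁ x ∧ ∁ y)    ∎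

  cyl′-fixed : ∀ j {x} → FixedBy x → FixedBy (cyl j x)
  cyl′-fixed j {x} fx = begin
    cyl i (cyl j x)  ≈⟨ cyl-comm i j x ⟩
    cyl j (cyl i x)  ≈⟨ cyl-cong j fx ⟩
    cyl j x          ∎

  diag-fixed : ∀ j k → i ≢ j → i ≢ k → FixedBy (diag j k)
  diag-fixed j k i≢j i≢k = ≈-fixed (diag-cyl j k i i≢j i≢k) (cyl-fixed _)

module _ {c ℓ : Level} (n : ℕ) (𝔅 : CylindricAlgebra ℕ c ℓ) where
  private
    module 𝔅 = CylindricAlgebra 𝔅
    open module F i = Fixed 𝔅 i

    ≥⇒≢toℕ : ∀ {i} → n ℕ.≤ i → (j : Fin n) → i ≢ toℕ j
    ≥⇒≢toℕ n≤i j i≡j = ℕ.<⇒≢ (ℕ.<-≤-trans (toℕ<n j) n≤i) (sym i≡j)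

  Nr : RawCylindricAlgebra (Fin n) (c ⊔ ℓ) ℓ
  Nr = record
    { Carrier = Σ 𝔅.Carrier λ b → ∀ i → n ℕ.≤ i → 𝔅.cyl i b 𝔅.≈ b
    ; _≈_     = λ x y → proj₁ x 𝔅.≈ proj₁ y
    ; _+_     = λ (x , fx) (y , fy) → x 𝔅.∨ y , λ i n≤i → ∨-fixed i (fx i n≤i) (fy i n≤i)
    ; _∙_     = λ (x , fx) (y , fy) → x 𝔅.∧ y , λ i n≤i → ∧-fixed i (fx i n≤i) (fy i n≤i)
    ; -_      = λ (x , fx) → 𝔅.∁ x , λ i n≤i → ∁-fixed i (fx i n≤i)
    ; 𝟘       = 𝔅.𝟘 , λ i _ → 𝔅.cyl-𝟘 i
    ; 𝟙       = 𝔅.𝟙 , λ i _ → 𝟙-fixed i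
    ; cyl     = λ j (x , fx) → 𝔅.cyl (toℕ j) x , λ i n≤i → cyl′-fixed i (toℕ j) (fx i n≤i)
    ; diag    = λ j k → 𝔅.diag (toℕ j) (toℕ k) ,
                λ i n≤i → diag-fixed i (toℕ j) (toℕ k) (≥⇒≢toℕ n≤i j) (≥⇒≢toℕ n≤i k)
    }

-- The levels of 𝔅 are those of 𝔉𝔪 T.  Allowing larger carriers would
-- add nothing: the subalgebra of 𝔅 generated by Nr n 𝔅 has the same neat
-- n-reduct, and is countable when 𝔄 is.

NrCAω : (n : ℕ) → Pred (RawCylindricAlgebra (Fin n) 0ℓ (suc 0ℓ)) (suc (suc 0ℓ))
NrCAω n 𝔄 = Σ (CylindricAlgebra ℕ 0ℓ (suc 0ℓ)) λ 𝔅 → 𝔄 ≅ Nr n 𝔅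

------------------------------------------------------------------------

record Signature : Set₁ where
  field
    Symbol : Set
    arity  : Symbol → ℕ

Countable : Signature → Set
Countable σ = Signature.Symbol σ ↣ ℕ

module Logic (σ : Signature) (n : ℕ) where
  open Signature σ

  infix  9 _≐_
  infix  8 ¬̇_
  infixr 7 _∧̇_
  infixr 6 _∨̇_
  infixr 5 _⇒̇_
  infix  4 _⇔̇_

  data Formula : Set where
    rel  : (R : Symbol) → Vec (Fin n) (arity R) → Formula
    _≐_  : Fin n → Fin n → Formula
    ⊥̇    : Formula
    ¬̇_   : Formula → Formula
    _∧̇_  : Formula → Formula → Formula
    _∨̇_  : Formula → Formula → Formula
    ∃̇    : Fin n → Formula → Formula

  ⊤̇ : Formula
  ⊤̇ = ¬̇ ⊥̇

  _⇒̇_ _⇔̇_ : Formula → Formula → Formula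
  φ ⇒̇ ψ = ¬̇ φ ∨̇ ψ
  φ ⇔̇ ψ = (φ ⇒̇ ψ) ∧̇ (ψ ⇒̇ φ)

  FreeIn : Fin n → Formula → Set
  FreeIn i (rel R is) = i Vec.∈ is
  FreeIn i (j ≐ k)    = i ≡ j ⊎ i ≡ k
  FreeIn i ⊥̇          = ⊥
  FreeIn i (¬̇ φ)      = FreeIn i φ
  FreeIn i (φ ∧̇ ψ)    = FreeIn i φ ⊎ FreeIn i ψ
  FreeIn i (φ ∨̇ ψ)    = FreeIn i φ ⊎ FreeIn i ψ
  FreeIn i (∃̇ j φ)    = i ≢ j × FreeIn i φ

  Sentence : Pred Formula 0ℓ
  Sentence φ = ∀ i → ¬ FreeIn i φ

  record Theory : Set₁ where
    field
      Axiom    : Pred Formula 0ℓ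
      sentence : ∀ {φ} → φ ∈ Axiom → Sentence φ

  record Structure : Set₁ where
    field
      Carrier  : Set
      nonempty : Carrier
      interp   : (R : Symbol) → Vec Carrier (arity R) → Set

  infix 3 _⟨_⟩⊨_ _⊨_

  _⟨_⟩⊨_ : (M : Structure) → Vec (Structure.Carrier M) n → Formula → Set
  M ⟨ s ⟩⊨ rel R is = Structure.interp M R (map (lookup s) is)
  M ⟨ s ⟩⊨ i ≐ j    = lookup s i ≡ lookup s j
  M ⟨ s ⟩⊨ ⊥̇        = ⊥
  M ⟨ s ⟩⊨ ¬̇ φ      = ¬ (M ⟨ s ⟩⊨ φ)
  M ⟨ s ⟩⊨ φ ∧̇ ψ    = (M ⟨ s ⟩⊨ φ) × (M ⟨ s ⟩⊨ ψ)
  M ⟨ s ⟩⊨ φ ∨̇ ψ    = (M ⟨ s ⟩⊨ φ) ⊎ (M ⟨ s ⟩⊨ ψ)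
  M ⟨ s ⟩⊨ ∃̇ i φ    = ∃ λ a → M ⟨ s [ i ]≔ a ⟩⊨ φ

  IsModel : Theory → Pred Structure 0ℓ
  IsModel T M = ∀ {φ} → φ ∈ Theory.Axiom T → ∀ s → M ⟨ s ⟩⊨ φ

  _⊨_ : Theory → Formula → Set₁
  T ⊨ φ = ∀ M → IsModel T M → ∀ s → M ⟨ s ⟩⊨ φ

  Consistent : Theory → Set₁
  Consistent T = ¬ (T ⊨ ⊥̇)

  ConsistentWith : Theory → Formula → Set₁
  ConsistentWith T ψ = ¬ (T ⊨ ¬̇ ψ)

  Type : Set₁
  Type = Pred Formula 0ℓ

  NonPrincipal : Theory → Type → Set₁
  NonPrincipal T Γ =
    ¬ (∃ λ ψ → ConsistentWith T ψ × (∀ {φ} → φ ∈ Γ → T ⊨ ψ ⇒̇ φ))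

  Omits : Structure → Type → Set
  Omits M Γ = ¬ (∃ λ s → ∀ {φ} → φ ∈ Γ → M ⟨ s ⟩⊨ φ)

  -- The Tarski–Lindenbaum algebra; its quotient is rendered by _≈_.
  𝔉𝔪 : Theory → RawCylindricAlgebra (Fin n) 0ℓ (suc 0ℓ)
  𝔉𝔪 T = record
    { Carrier = Formula
    ; _≈_     = λ φ ψ → T ⊨ φ ⇔̇ ψ
    ; _+_     = _∨̇_
    ; _∙_     = _∧̇_
    ; -_      = ¬̇_
    ; 𝟘       = ⊥̇
    ; 𝟙       = ⊤̇
    ; cyl     = ∃̇
    ; diag    = _≐_
    }

-- A countable theory is a theory in a countable signature.  Families of
-- types indexed by K may repeat members.

OTT : Set → Set₂
OTT K =
  (n : ℕ) → 2 ℕ.< n →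
  (σ : Signature) → Countable σ → let open Logic σ n in
  (T : Theory) → Consistent T → NrCAω n (𝔉𝔪 T) →
  (Γ : K → Type) → (∀ k → NonPrincipal T (Γ k)) →
  ∃ λ M → IsModel T M × (∀ k → Omits M (Γ k))

{-# OPTIONS --safe #-}
module Submission where

-- Consider the propositional theory of a Dedekind cut in the unit interval.
-- Its language has a sentence letter (nullary relation symbol) for every
-- rational q, read "q belongs to the cut"; its axioms say that the letters
-- describe a down-closed set containing 0 but not 1, and that the universe
-- has exactly one element.
--
-- Since the universe is a singleton, quantifiers are vacuous and every
-- equation is true.  Hence the Tarski–Lindenbaum algebra is a Boolean
-- algebra with identity cylindrifications and unit diagonals, and it is its
-- own neat reduct: the same Boolean algebra with ω many identity
-- cylindrifications is in CA_ω and all its elements are n-dimensional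
-- (singleton⇒NrCAω).
--
-- A model of the theory has a supremum, a real number.  To a nowhere dense
-- set N assign the type consisting of the formulas "not (a in the cut and b
-- outside it)" for all a and b such that [a , b] lies in an open interval
-- missing N.  A model whose supremum is in N realizes this type
-- (realizes).  The type is non-principal (nonPrincipal): a formula true
-- in some model mentions finitely many letters, so it stays true in all
-- models whose cut contains p but not r, for certain rationals p < r
-- (determined), and as N is nowhere dense, some such cut has its supremum in
-- an interval missing N (avoidingModel).
--
-- If the sets N k cover the line, the supremum of any model lies in some
-- N k, so no model omits all the types assigned to them.

open import Defs
open import Algebra.Lattice.Bundles using (BooleanAlgebra)
import Algebra.Lattice.Properties.BooleanAlgebra as BAProperties
open import Algebra.Lattice.Structures using (IsBooleanAlgebra)
open import Algebra.Lattice.Structures.Biased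
  using (isDistributiveLatticeʳʲᵐ; isBooleanAlgebraʳ)
open import Axiom.ExcludedMiddle using (ExcludedMiddle)
open import Data.Empty using (⊥-elim)
open import Data.Fin.Patterns using (0F; 1F)
open import Data.Integer.Base using (ℤ; +_; -[1+_])
open import Data.Nat.Base as ℕ using (ℕ; zero; suc; z≤n; s≤s)
import Data.Nat.Properties as ℕ
open import Data.Product as Product using (∃; _×_; _,_; proj₁; proj₂; swap)
open import Data.Product.Function.NonDependent.Propositional using (_×-⇔_)
open import Data.Rational.Base as ℚ using (ℚ; mkℚ; 0ℚ; 1ℚ)
import Data.Rational.Properties as ℚ
open import Data.Sum.Base as Sum using (_⊎_; inj₁; inj₂)
open import Data.Sum.Function.Propositional using (_⊎-⇔_)
open import Data.Unit.Base using (⊤; tt)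
open import Data.Vec.Base using (Vec; []; _∷_; lookup; replicate)
open import Function.Base using (id; _∘_)
open import Function.Bundles using (_⇔_; _↣_; mk⇔; mk↣; Equivalence)
open import Function.Properties.Equivalence using (⇔-isEquivalence)
open import Function.Related.TypeIsomorphisms using (¬-cong-⇔)
open import Level as Level using (0ℓ)
open import Relation.Binary.PropositionalEquality
  using (_≡_; refl; sym; cong; cong₂; subst)
open import Relation.Binary.Structures using (IsEquivalence)
open import Relation.Nullary.Decidable as Dec
  using (yes; no; True; toWitness; fromWitness; decidable-stable; from-yes)
open import Relation.Nullary.Negation using (¬_; contradiction)
open import Relation.Unary using (Pred; _∈_; _∉_)

open Equivalence using (to; from)
module ⇔ {ℓ} = IsEquivalence (⇔-isEquivalence {ℓ})

------------------------------------------------------------------------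
-- The order of the rationals

≤⇒<⊎≡ : ∀ {p q} → p ℚ.≤ q → p ℚ.< q ⊎ p ≡ q
≤⇒<⊎≡ {p} {q} p≤q with p ℚ.<? q
... | yes p<q = inj₁ p<q
... | no  p≮q = inj₂ (ℚ.≤-antisym p≤q (ℚ.≮⇒≥ p≮q))

<⇒≱ : ∀ {p q} → p ℚ.< q → ¬ q ℚ.≤ p
<⇒≱ p<q q≤p = ℚ.<-irrefl refl (ℚ.<-≤-trans p<q q≤p)

⊔-preserves : ∀ (P : Pred ℚ 0ℓ) {p q} → P p → P q → P (p ℚ.⊔ q)
⊔-preserves P {p} {q} Pp Pq =
  Sum.[ (λ eq → subst P (sym eq) Pp) , (λ eq → subst P (sym eq) Pq) ]′ (ℚ.⊔-sel p q)

⊓-preserves : ∀ (P : Pred ℚ 0ℓ) {p q} → P p → P q → P (p ℚ.⊓ q)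
⊓-preserves P {p} {q} Pp Pq =
  Sum.[ (λ eq → subst P (sym eq) Pp) , (λ eq → subst P (sym eq) Pq) ]′ (ℚ.⊓-sel p q)

<-successor : ∀ q → q ℚ.< q ℚ.+ 1ℚ
<-successor q = subst (ℚ._< q ℚ.+ 1ℚ) (ℚ.+-identityʳ q)
  (ℚ.+-monoʳ-< q (from-yes (0ℚ ℚ.<? 1ℚ)))

predecessor-< : ∀ q → q ℚ.- 1ℚ ℚ.< q
predecessor-< q = subst (q ℚ.- 1ℚ ℚ.<_) (ℚ.+-identityʳ q)
  (ℚ.+-monoʳ-< q (from-yes ((ℚ.- 1ℚ) ℚ.<? 0ℚ)))

------------------------------------------------------------------------
-- Discrete cylindric algebras

-- Every Boolean algebra is a cylindric algebra of any dimension, with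
-- identity cylindrifications and unit diagonals.
discrete : ∀ {c ℓ} (I : Set) → BooleanAlgebra c ℓ → CylindricAlgebra I c ℓ
discrete I B = record
  { booleanAlgebra = B
  ; cyl            = λ _ x → x
  ; diag           = λ _ _ → B.⊤
  ; cyl-cong       = λ _ x≈y → x≈y
  ; cyl-𝟘          = λ _ → B.refl
  ; cyl-incr       = λ _ → ∧-idem
  ; cyl-∧          = λ _ _ _ → B.refl
  ; cyl-comm       = λ _ _ _ → B.refl
  ; diag-𝟙         = λ _ → B.refl
  ; diag-cyl       = λ _ _ _ _ _ → B.sym (∧-idem B.⊤)
  ; diag-sub       = λ _ _ x _ →
      B.trans (B.∧-cong (∧-identityˡ x) (∧-identityˡ (B.¬ x))) (B.∧-complementʳ x)
  }
  where
  module B = BooleanAlgebra B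
  open BAProperties B using (∧-idem; ∧-identityˡ)

-- A type with at most one element.  Structures are nonempty, so for their
-- carriers this means exactly one.
Singleton : Set → Set
Singleton A = ∀ (x y : A) → x ≡ y

Vec-singleton : ∀ {A n} → Singleton A → Singleton (Vec A n)
Vec-singleton A₁ []       []       = refl
Vec-singleton A₁ (x ∷ xs) (y ∷ ys) = cong₂ _∷_ (A₁ x y) (Vec-singleton A₁ xs ys)

------------------------------------------------------------------------
-- The Tarski–Lindenbaum algebra

module Lindenbaum (em : ∀ {ℓ} → ExcludedMiddle ℓ)
  {σ : Signature} {n : ℕ} (T : Logic.Theory σ n) where
  open Logic σ n

  infix 4 _≋_

  -- Equivalence modulo T: satisfaction by the same assignments in all models
  -- of T.  By excluded middle this is the equality of 𝔉𝔪 T, which says that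
  -- T entails the material equivalence.
  record _≋_ (φ ψ : Formula) : Set₁ where
    constructor equivalent
    field sat : ∀ M → IsModel T M → ∀ s → (M ⟨ s ⟩⊨ φ) ⇔ (M ⟨ s ⟩⊨ ψ)
  open _≋_

  ≋⇒⊨⇔̇ : ∀ {φ ψ} → φ ≋ ψ → T ⊨ φ ⇔̇ ψ
  ≋⇒⊨⇔̇ φ≋ψ M M⊨T s = implies (to (sat φ≋ψ M M⊨T s)) , implies (from (sat φ≋ψ M M⊨T s))
    where
    implies : ∀ {A B : Set} → (A → B) → ¬ A ⊎ B
    implies {A} f with em {P = A}
    ... | yes a = inj₂ (f a)
    ... | no ¬a = inj₁ ¬a

  ⊨⇔̇⇒≋ : ∀ {φ ψ} → T ⊨ φ ⇔̇ ψ → φ ≋ ψ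
  ⊨⇔̇⇒≋ T⊨φ⇔ψ = equivalent λ M M⊨T s →
    mk⇔ (apply (proj₁ (T⊨φ⇔ψ M M⊨T s))) (apply (proj₂ (T⊨φ⇔ψ M M⊨T s)))
    where
    apply : ∀ {A B : Set} → ¬ A ⊎ B → A → B
    apply (inj₁ ¬a) a = contradiction a ¬a
    apply (inj₂ b)  _ = b

  ≋-isEquivalence : IsEquivalence _≋_
  ≋-isEquivalence = record
    { refl  = equivalent λ _ _ _ → ⇔.refl
    ; sym   = λ p → equivalent λ M m s → ⇔.sym (sat p M m s)
    ; trans = λ p q → equivalent λ M m s → ⇔.trans (sat p M m s) (sat q M m s)
    }

  isBooleanAlgebra : IsBooleanAlgebra _≋_ _∨̇_ _∧̇_ ¬̇_ ⊤̇ ⊥̇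
  isBooleanAlgebra = isBooleanAlgebraʳ record
    { isDistributiveLattice = isDistributiveLatticeʳʲᵐ record
      { isLattice = record
        { isEquivalence = ≋-isEquivalence
        ; ∨-comm  = λ _ _ → equivalent λ _ _ _ → mk⇔ Sum.swap Sum.swap
        ; ∨-assoc = λ _ _ _ → equivalent λ _ _ _ → mk⇔ Sum.assocʳ Sum.assocˡ
        ; ∨-cong  = λ p q → equivalent λ M m s → sat p M m s ⊎-⇔ sat q M m s
        ; ∧-comm  = λ _ _ → equivalent λ _ _ _ → mk⇔ swap swap
        ; ∧-assoc = λ _ _ _ → equivalent λ _ _ _ → mk⇔ Product.assocʳ′ Product.assocˡ′
        ; ∧-cong  = λ p q → equivalent λ M m s → sat p M m s ×-⇔ sat q M m s
        ; absorptive =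
            (λ _ _ → equivalent λ _ _ _ → mk⇔ Sum.[ id , proj₁ ]′ inj₁) ,
            (λ _ _ → equivalent λ _ _ _ → mk⇔ proj₁ (λ a → a , inj₁ a))
        }
      ; ∨-distribʳ-∧ = λ _ _ _ → equivalent λ _ _ _ → mk⇔
          Sum.[ Product.map inj₁ inj₁ , (λ a → inj₂ a , inj₂ a) ]′
          λ { (inj₁ b , inj₁ c) → inj₁ (b , c)
            ; (inj₂ a , _)      → inj₂ a
            ; (_      , inj₂ a) → inj₂ a }
      }
    ; ∨-complementʳ = λ φ → equivalent λ M _ s → mk⇔
        (λ _ → id) (λ _ → Dec.toSum (em {P = M ⟨ s ⟩⊨ φ}))
    ; ∧-complementʳ = λ _ → equivalent λ _ _ _ → mk⇔ (λ (a , ¬a) → ¬a a) ⊥-elim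
    ; ¬-cong        = λ p → equivalent λ M m s → ¬-cong-⇔ (sat p M m s)
    }

  booleanAlgebra : BooleanAlgebra 0ℓ (Level.suc 0ℓ)
  booleanAlgebra = record { isBooleanAlgebra = isBooleanAlgebra }

  -- Over singleton universes quantifiers are vacuous and equations are
  -- true, so 𝔉𝔪 T is the neat reduct of a discrete algebra of dimension ω.
  singleton⇒NrCAω : (∀ M → IsModel T M → Singleton (Structure.Carrier M)) →
                    NrCAω n (𝔉𝔪 T)
  singleton⇒NrCAω M₁ = discrete ℕ booleanAlgebra , record
    { to         = λ φ → φ , λ _ _ → ≋-refl
    ; cong       = λ {φ} {ψ} → ⊨⇔̇⇒≋ {φ} {ψ}
    ; injective  = ≋⇒⊨⇔̇
    ; surjective = λ (φ , _) → φ , λ {ψ} → ⊨⇔̇⇒≋ {ψ} {φ}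
    ; +-homo     = λ _ _ → ≋-refl
    ; ∙-homo     = λ _ _ → ≋-refl
    ; -‿homo     = λ _ → ≋-refl
    ; 𝟘-homo     = ≋-refl
    ; 𝟙-homo     = ≋-refl
    ; cyl-homo   = λ i φ → equivalent λ M m s → mk⇔
        (λ (_ , h) → subst (M ⟨_⟩⊨ φ) (Vec-singleton (M₁ M m) _ _) h)
        (λ h → Structure.nonempty M ,
               subst (M ⟨_⟩⊨ φ) (Vec-singleton (M₁ M m) _ _) h)
    ; diag-homo  = λ i j → equivalent λ M m s → mk⇔
        (λ _ → id)
        (λ _ → M₁ M m (lookup s i) (lookup s j))
    }
    where open IsEquivalence ≋-isEquivalence using () renaming (refl to ≋-refl)

------------------------------------------------------------------------
-- Real numbers

-- A proper nonempty down-closed set of rationals.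
record IsCut (S : Pred ℚ 0ℓ) : Set where
  field
    closed : ∀ {q r} → q ℚ.< r → S r → S q
    below  : ∃ λ q → S q
    above  : ∃ λ q → ¬ S q

  closed-≤ : ∀ {q r} → q ℚ.≤ r → S r → S q
  closed-≤ q≤r Sr with ≤⇒<⊎≡ q≤r
  ... | inj₁ q<r  = closed q<r Sr
  ... | inj₂ refl = Sr

-- The least upper bound of S.  Membership of the endpoint in S is
-- immaterial, so both halves are made rounded by hand.
sup : (∀ {ℓ} → ExcludedMiddle ℓ) → ∀ {S} → IsCut S → ℝ
sup em {S} cut = record
  { L           = L
  ; U           = U
  ; L-inhabited = let (q , Sq) = below in q ℚ.- 1ℚ , q , predecessor-< q , Sq
  ; U-inhabited = let (q , ¬Sq) = above in q ℚ.+ 1ℚ , q , <-successor q , ¬Sq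
  ; L-rounded   = λ p → mk⇔
      (λ (r , p<r , Sr) → let (q , p<q , q<r) = ℚ.<-dense p<r in q , p<q , r , q<r , Sr)
      (λ (q , p<q , r , q<r , Sr) → r , ℚ.<-trans p<q q<r , Sr)
  ; U-rounded   = λ q → mk⇔
      (λ (r , r<q , ¬Sr) → let (p , r<p , p<q) = ℚ.<-dense r<q in p , p<q , r , r<p , ¬Sr)
      (λ (p , p<q , r , r<p , ¬Sr) → r , ℚ.<-trans r<p p<q , ¬Sr)
  ; disjoint    = λ q ((r , q<r , Sr) , (r′ , r′<q , ¬Sr′)) →
      ¬Sr′ (closed (ℚ.<-trans r′<q q<r) Sr)
  ; located     = located
  }
  where
  open IsCut cut
  L U : Pred ℚ 0ℓ
  L q = ∃ λ r → q ℚ.< r × S r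
  U q = ∃ λ r → r ℚ.< q × ¬ S r

  located : ∀ p q → p ℚ.< q → L p ⊎ U q
  located p q p<q with ℚ.<-dense p<q
  ... | m , p<m , m<q with em {P = S m}
  ...   | yes Sm = inj₁ (m , p<m , Sm)
  ...   | no ¬Sm = inj₂ (m , m<q , ¬Sm)

L-closed : ∀ x {a b} → a ℚ.≤ b → ℝ.L x b → ℝ.L x a
L-closed x {a} a≤b Lb with ≤⇒<⊎≡ a≤b
... | inj₁ a<b  = from (ℝ.L-rounded x a) (_ , a<b , Lb)
... | inj₂ refl = Lb

U-closed : ∀ x {a b} → a ℚ.≤ b → ℝ.U x a → ℝ.U x b
U-closed x {b = b} a≤b Ua with ≤⇒<⊎≡ a≤b
... | inj₁ a<b  = from (ℝ.U-rounded x b) (_ , a<b , Ua)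
... | inj₂ refl = Ua

Interval-nonempty⇒< : ∀ {a b} x → x ∈ Interval a b → a ℚ.< b
Interval-nonempty⇒< {a} {b} x (La , Ub) = ℚ.≰⇒> λ b≤a →
  ℝ.disjoint x b (L-closed x b≤a La , Ub)

Interval-∩ : ∀ {a b a′ b′} x → x ∈ Interval a b → x ∈ Interval a′ b′ →
             x ∈ Interval (a ℚ.⊔ a′) (b ℚ.⊓ b′)
Interval-∩ x (La , Ub) (La′ , Ub′) =
  ⊔-preserves (ℝ.L x) La La′ , ⊓-preserves (ℝ.U x) Ub Ub′

≤-isCut : ∀ m → IsCut (ℚ._≤ m)
≤-isCut m = record
  { closed = λ q<r r≤m → ℚ.≤-trans (ℚ.<⇒≤ q<r) r≤m
  ; below  = m , ℚ.≤-refl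
  ; above  = m ℚ.+ 1ℚ , <⇒≱ (<-successor m)
  }

-- The open interval from a to b contains no point of N.
Misses : Pred ℝ 0ℓ → ℚ → ℚ → Set₁
Misses N a b = ∀ x → x ∈ Interval a b → x ∉ N

nowhereDense⇒misses : (∀ {ℓ} → ExcludedMiddle ℓ) →
  ∀ {N} → NowhereDense N → ∀ {p r} → p ℚ.< r →
  ∃ λ a → ∃ λ b → a ℚ.< b × p ℚ.≤ a × b ℚ.≤ r × Misses N a b
nowhereDense⇒misses em {N} nd {p} {r} p<r = decidable-stable em λ none →
  let (m , p<m , m<r)    = ℚ.<-dense p<r
      (m′ , m<m′ , m′<r) = ℚ.<-dense m<r
      -- Without such a and b, every y in the interval is adherent to N: if
      -- a neighbourhood of y missed N, then its intersection with the
      -- interval would supply a and b.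
      adherent : ∀ y → y ∈ Interval p r → y ∈ Closure N
      adherent = λ y y∈ p′ q′ y∈′ → decidable-stable em λ empty →
        none ( p ℚ.⊔ p′ , r ℚ.⊓ q′ , Interval-nonempty⇒< y (Interval-∩ y y∈ y∈′)
             , ℚ.p≤p⊔q p p′ , ℚ.p⊓q≤p r q′
             , λ z (Lz , Uz) z∈N → empty
                 ( z
                 , ( L-closed z (ℚ.p≤q⊔p p p′) Lz
                   , U-closed z (ℚ.p⊓q≤q r q′) Uz )
                 , z∈N ) )
  in nd (sup em (≤-isCut m))
       (p , r , ((m , p<m , ℚ.≤-refl) , (m′ , m′<r , <⇒≱ m<m′)) , adherent)

------------------------------------------------------------------------
-- The theory of a cut

-- The injective pairing whose binary expansion is that of k followed by a
-- zero and m ones.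
pair : ℕ → ℕ → ℕ
pair zero    k = 2 ℕ.* k
pair (suc m) k = suc (2 ℕ.* pair m k)

pair-injective : ∀ m k m′ k′ → pair m k ≡ pair m′ k′ → m ≡ m′ × k ≡ k′
pair-injective zero    k zero     k′ eq = refl , ℕ.*-cancelˡ-≡ _ _ 2 eq
pair-injective zero    k (suc m′) k′ eq = contradiction eq (ℕ.even≢odd k (pair m′ k′))
pair-injective (suc m) k zero     k′ eq = contradiction (sym eq) (ℕ.even≢odd k′ (pair m k))
pair-injective (suc m) k (suc m′) k′ eq
  with refl , k≡k′ ← pair-injective m k m′ k′ (ℕ.*-cancelˡ-≡ _ _ 2 (ℕ.suc-injective eq))
  = refl , k≡k′

codeℤ : ℤ → ℕ
codeℤ (+ n)    = pair 0 n
codeℤ -[1+ n ] = pair 1 n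

codeℤ-injective : ∀ i j → codeℤ i ≡ codeℤ j → i ≡ j
codeℤ-injective (+ m)    (+ n)    eq = cong +_ (proj₂ (pair-injective 0 m 0 n eq))
codeℤ-injective (+ m)    -[1+ n ] eq with () ← proj₁ (pair-injective 0 m 1 n eq)
codeℤ-injective -[1+ m ] (+ n)    eq with () ← proj₁ (pair-injective 1 m 0 n eq)
codeℤ-injective -[1+ m ] -[1+ n ] eq = cong -[1+_] (proj₂ (pair-injective 1 m 1 n eq))

ℚ-countable : ℚ ↣ ℕ
ℚ-countable = mk↣ {to = code} injective
  where
  code : ℚ → ℕ
  code (mkℚ i d _) = pair (codeℤ i) d
  injective : ∀ {p q} → code p ≡ code q → p ≡ q
  injective {mkℚ i d _} {mkℚ j e _} eq
    with i≡j , refl ← pair-injective (codeℤ i) d (codeℤ j) e eq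
    with refl ← codeℤ-injective i j i≡j = refl

-- A nullary relation symbol for every rational.
cutSignature : Signature
cutSignature = record { Symbol = ℚ ; arity = λ _ → 0 }

-- Any finite number of variables greater than two would do.
open Logic cutSignature 3

-- The letter of q, asserting that q belongs to the cut.
⟦_⟧ : ℚ → Formula
⟦ q ⟧ = rel q []

-- There are no two distinct elements.
oneElement : Formula
oneElement = ¬̇ ∃̇ 0F (∃̇ 1F (¬̇ (0F ≐ 1F)))

-- The universe is a singleton and the true letters form a down-closed set
-- containing 0 but not 1.  The two bounds ensure that the set has a
-- supremum.
data CutAxiom : Pred Formula 0ℓ where
  singleton : CutAxiom oneElement
  closed    : ∀ {q r} → q ℚ.< r → CutAxiom (⟦ r ⟧ ⇒̇ ⟦ q ⟧)
  lower     : CutAxiom ⟦ 0ℚ ⟧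
  upper     : CutAxiom (¬̇ ⟦ 1ℚ ⟧)

cutTheory : Theory
cutTheory = record { Axiom = CutAxiom ; sentence = sentence }
  where
  letter-sentence : ∀ q → Sentence ⟦ q ⟧
  letter-sentence q i ()
  sentence : ∀ {φ} → φ ∈ CutAxiom → Sentence φ
  sentence singleton _ (i≢0 , i≢1 , inj₁ i≡0) = i≢0 i≡0
  sentence singleton _ (i≢0 , i≢1 , inj₂ i≡1) = i≢1 i≡1
  sentence (closed {q} {r} _) i = Sum.[ letter-sentence r i , letter-sentence q i ]′
  sentence lower = letter-sentence 0ℚ
  sentence upper = letter-sentence 1ℚ

-- The set of rationals whose letters are true in M.
Cut : Structure → Pred ℚ 0ℓ
Cut M q = Structure.interp M q []

-- The one-element structure whose true letters are those of q ≤ m.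
below : ℚ → Structure
below m = record { Carrier = ⊤ ; nonempty = tt ; interp = λ q _ → q ℚ.≤ m }

below-isModel : ∀ {m} → 0ℚ ℚ.≤ m → m ℚ.< 1ℚ → IsModel cutTheory (below m)
below-isModel     0≤m m<1 singleton _ = λ (_ , _ , x≢y) → x≢y refl
below-isModel {m} 0≤m m<1 (closed {q} {r} q<r) _ with r ℚ.≤? m
... | yes r≤m = inj₂ (ℚ.≤-trans (ℚ.<⇒≤ q<r) r≤m)
... | no  r≰m = inj₁ r≰m
below-isModel     0≤m m<1 lower _ = 0≤m
below-isModel     0≤m m<1 upper _ = <⇒≱ m<1

cutTheory-consistent : Consistent cutTheory
cutTheory-consistent T⊨⊥ = T⊨⊥ (below 0ℚ)
  (below-isModel ℚ.≤-refl (from-yes (0ℚ ℚ.<? 1ℚ))) (tt ∷ tt ∷ tt ∷ [])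

module Models (em : ∀ {ℓ} → ExcludedMiddle ℓ) where

  assignment : ∀ M → Vec (Structure.Carrier M) 3
  assignment M = replicate 3 (Structure.nonempty M)

  model-singleton : ∀ M → IsModel cutTheory M → Singleton (Structure.Carrier M)
  model-singleton M M⊨T x y = decidable-stable em λ x≢y →
    M⊨T singleton (assignment M) (x , y , x≢y)

  model-isCut : ∀ M → IsModel cutTheory M → IsCut (Cut M)
  model-isCut M M⊨T = record
    { closed = λ q<r r∈M → Sum.[ contradiction r∈M , id ]′ (M⊨T (closed q<r) s)
    ; below  = 0ℚ , M⊨T lower s
    ; above  = 1ℚ , M⊨T upper s
    }
    where s = assignment M

  -- Every model of the theory with p in the cut and r outside agrees with M
  -- on φ.
  DeterminedBy : Structure → Formula → ℚ → ℚ → Set₁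
  DeterminedBy M φ p r = ∀ M′ → IsModel cutTheory M′ → p ∈ Cut M′ → r ∉ Cut M′ →
                         ∀ s s′ → (M ⟨ s ⟩⊨ φ) ⇔ (M′ ⟨ s′ ⟩⊨ φ)

  -- The truth value of a formula depends on finitely many letters, hence on
  -- the largest of them in the cut and the smallest outside; if there are
  -- none, 0 and 1 serve instead.
  determined : ∀ M → IsModel cutTheory M → ∀ φ →
    ∃ λ p → ∃ λ r → p ∈ Cut M × r ∉ Cut M × DeterminedBy M φ p r
  determined M M⊨T = go
    where
    0∈M : 0ℚ ∈ Cut M
    0∈M = M⊨T lower (assignment M)

    1∉M : 1ℚ ∉ Cut M
    1∉M = M⊨T upper (assignment M)

    binary : ∀ φ ψ χ →
      (∀ M′ s s′ → (M ⟨ s ⟩⊨ φ) ⇔ (M′ ⟨ s′ ⟩⊨ φ) → (M ⟨ s ⟩⊨ ψ) ⇔ (M′ ⟨ s′ ⟩⊨ ψ) →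
                   (M ⟨ s ⟩⊨ χ) ⇔ (M′ ⟨ s′ ⟩⊨ χ)) →
      ∀ {p q r t} → DeterminedBy M φ p r → DeterminedBy M ψ q t →
      DeterminedBy M χ (p ℚ.⊔ q) (r ℚ.⊓ t)
    binary φ ψ χ f {p} {q} {r} {t} d e M′ M′⊨T p⊔q∈ r⊓t∉ s s′ = f M′ s s′
      (d M′ M′⊨T (closed-≤ (ℚ.p≤p⊔q p q) p⊔q∈) (r⊓t∉ ∘ closed-≤ (ℚ.p⊓q≤p r t)) s s′)
      (e M′ M′⊨T (closed-≤ (ℚ.p≤q⊔p p q) p⊔q∈) (r⊓t∉ ∘ closed-≤ (ℚ.p⊓q≤q r t)) s s′)
      where open IsCut (model-isCut M′ M′⊨T) using (closed-≤)

    go : ∀ φ → ∃ λ p → ∃ λ r → p ∈ Cut M × r ∉ Cut M × DeterminedBy M φ p r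
    go (rel q []) with em {P = q ∈ Cut M}
    ... | yes q∈M = q , 1ℚ , q∈M , 1∉M ,
      λ _ _ q∈M′ _ _ _ → mk⇔ (λ _ → q∈M′) (λ _ → q∈M)
    ... | no q∉M  = 0ℚ , q , 0∈M , q∉M ,
      λ _ _ _ q∉M′ _ _ → mk⇔ (λ q∈M → contradiction q∈M q∉M)
                             (λ q∈M′ → contradiction q∈M′ q∉M′)
    go (i ≐ j) = 0ℚ , 1ℚ , 0∈M , 1∉M , λ M′ M′⊨T _ _ _ _ →
      mk⇔ (λ _ → model-singleton M′ M′⊨T _ _) (λ _ → model-singleton M M⊨T _ _)
    go ⊥̇ = 0ℚ , 1ℚ , 0∈M , 1∉M , λ _ _ _ _ _ _ → ⇔.refl
    go (¬̇ φ) with p , r , p∈ , r∉ , d ← go φ =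
      p , r , p∈ , r∉ , λ M′ M′⊨T p∈′ r∉′ s s′ → ¬-cong-⇔ (d M′ M′⊨T p∈′ r∉′ s s′)
    go (φ ∧̇ ψ) with p , r , p∈ , r∉ , d ← go φ | q , t , q∈ , t∉ , e ← go ψ =
      p ℚ.⊔ q , r ℚ.⊓ t ,
      ⊔-preserves (_∈ Cut M) p∈ q∈ , ⊓-preserves (_∉ Cut M) r∉ t∉ ,
      binary φ ψ (φ ∧̇ ψ) (λ _ _ _ → _×-⇔_) d e
    go (φ ∨̇ ψ) with p , r , p∈ , r∉ , d ← go φ | q , t , q∈ , t∉ , e ← go ψ =
      p ℚ.⊔ q , r ℚ.⊓ t ,
      ⊔-preserves (_∈ Cut M) p∈ q∈ , ⊓-preserves (_∉ Cut M) r∉ t∉ ,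
      binary φ ψ (φ ∨̇ ψ) (λ _ _ _ → _⊎-⇔_) d e
    go (∃̇ i φ) with p , r , p∈ , r∉ , d ← go φ =
      p , r , p∈ , r∉ , λ M′ M′⊨T p∈′ r∉′ s s′ →
        mk⇔ (λ (_ , h) → Structure.nonempty M′ , to (d M′ M′⊨T p∈′ r∉′ _ _) h)
            (λ (_ , h) → Structure.nonempty M , from (d M′ M′⊨T p∈′ r∉′ _ _) h)

------------------------------------------------------------------------
-- The types of nowhere dense sets

  -- Some open interval around [a , b] misses N.  The case b < a is not
  -- excluded: it is trivially true, and typeOf then merely asserts an
  -- instance of down-closure.
  Avoids : Pred ℝ 0ℓ → ℚ → ℚ → Set₁
  Avoids N a b = ∃ λ a′ → ∃ λ b′ → a′ ℚ.< a × b ℚ.< b′ × Misses N a′ b′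

  -- The type saying that the supremum of the cut is in no [a , b] that N
  -- avoids.  The condition Avoids N a b is a large proposition, since it
  -- quantifies over reals; excluded middle replaces it by the small
  -- proposition True em.
  typeOf : Pred ℝ 0ℓ → Type
  typeOf N φ = ∃ λ a → ∃ λ b →
    φ ≡ ¬̇ (⟦ a ⟧ ∧̇ ¬̇ ⟦ b ⟧) × True (em {P = Avoids N a b})

  -- If a is in the cut and b outside, the supremum lies in [a , b], hence in
  -- the surrounding open interval, which therefore does not miss N.
  realizes : ∀ N M (M⊨T : IsModel cutTheory M) →
             sup em (model-isCut M M⊨T) ∈ N → ¬ Omits M (typeOf N)
  realizes N M M⊨T x∈N omits = omits (assignment M , satisfied)
    where
    satisfied : ∀ {φ} → φ ∈ typeOf N → M ⟨ assignment M ⟩⊨ φ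
    satisfied (a , b , refl , avoids) (a∈M , b∉M) =
      let (a′ , b′ , a′<a , b<b′ , misses) = toWitness avoids
      in misses _ ((a , a′<a , a∈M) , (b , b<b′ , b∉M)) x∈N

  -- A formula true in some model stays true when the cut is moved to a
  -- suitable place in an interval missing N.
  avoidingModel : ∀ {N} → NowhereDense N →
    ∀ M → IsModel cutTheory M → ∀ s ψ → M ⟨ s ⟩⊨ ψ →
    ∃ λ m → ∃ λ n → m ℚ.< n × Avoids N m n ×
    IsModel cutTheory (below m) × (∀ t → below m ⟨ t ⟩⊨ ψ)
  avoidingModel nd M M⊨T s ψ M⊨ψ
    with p , r , p∈M , r∉M , d ← determined M M⊨T ψ
    -- p may be negative and r may exceed 1, but the cut of a model must lie
    -- between 0 and 1.
    with p⁺∈M ← ⊔-preserves (_∈ Cut M) p∈M (M⊨T lower s)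
       | r⁻∉M ← ⊓-preserves (_∉ Cut M) r∉M (M⊨T upper s)
    with p⁺<r⁻ ← ℚ.≰⇒> (λ r⁻≤p⁺ → r⁻∉M (IsCut.closed-≤ (model-isCut M M⊨T) r⁻≤p⁺ p⁺∈M))
    with a , b , a<b , p⁺≤a , b≤r⁻ , misses ← nowhereDense⇒misses em nd p⁺<r⁻
    with m , a<m , m<b ← ℚ.<-dense a<b
    with n , m<n , n<b ← ℚ.<-dense m<b
    = m , n , m<n , (a , b , a<m , n<b , misses) , below-m⊨T ,
      λ t → to (d (below m) below-m⊨T p≤m r≰m s t) M⊨ψ
    where
    p⁺≤m = ℚ.≤-trans p⁺≤a (ℚ.<⇒≤ a<m)
    m<r⁻ = ℚ.<-≤-trans m<b b≤r⁻
    p≤m  = ℚ.≤-trans (ℚ.p≤p⊔q p 0ℚ) p⁺≤m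
    r≰m  = <⇒≱ (ℚ.<-≤-trans m<r⁻ (ℚ.p⊓q≤p r 1ℚ))
    below-m⊨T = below-isModel
      (ℚ.≤-trans (ℚ.p≤q⊔p p 0ℚ) p⁺≤m)
      (ℚ.<-≤-trans m<r⁻ (ℚ.p⊓q≤q r 1ℚ))

  -- For m < n as in avoidingModel, the model below m satisfies ψ and
  -- falsifies the member of the type given by m and n, so ψ does not entail
  -- that member.
  nonPrincipal : ∀ N → NowhereDense N → NonPrincipal cutTheory (typeOf N)
  nonPrincipal N nd (ψ , ψ-consistent , ψ⊨type) = ψ-consistent refute
    where
    notBetween : ∀ {m n} → Avoids N m n → cutTheory ⊨ ψ ⇒̇ ¬̇ (⟦ m ⟧ ∧̇ ¬̇ ⟦ n ⟧)
    notBetween {m} {n} avoids =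
      ψ⊨type {¬̇ (⟦ m ⟧ ∧̇ ¬̇ ⟦ n ⟧)} (m , n , refl , fromWitness avoids)

    refute : cutTheory ⊨ ¬̇ ψ
    refute M M⊨T s M⊨ψ =
      let (m , n , m<n , avoids , below-m⊨T , below-m⊨ψ) = avoidingModel nd M M⊨T s ψ M⊨ψ
          t = assignment (below m)
      in Sum.[ (λ ¬ψ → ¬ψ (below-m⊨ψ t)) , (λ ¬m∧n → ¬m∧n (ℚ.≤-refl , <⇒≱ m<n)) ]′
           (notBetween avoids (below m) below-m⊨T t)

theorem5p18 : (∀ {ℓ} → ExcludedMiddle ℓ) → (K : Set) → IsCovK K → ¬ OTT K
theorem5p18 em K isCovK ott =
  let (M , M⊨T , omits) = ott 3 (s≤s (s≤s (s≤s z≤n))) cutSignature ℚ-countable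
        cutTheory cutTheory-consistent
        (Lindenbaum.singleton⇒NrCAω em cutTheory model-singleton)
        (λ k → typeOf (N k)) (λ k → nonPrincipal (N k) (nowhereDense k))
      (k , x∈N) = covers (sup em (model-isCut M M⊨T))
  in realizes (N k) M M⊨T x∈N (omits k)
  where
  open IsCovK isCovK using (cover)
  open NowhereDenseCover cover
  open Models em
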